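{- Let $n \ge 2$ be an integer. If $n \geq 2$ is even, then \[\mathrm{ParseWords}(\mathrm{LeftCombTree}(n), \mathrm{RightCrookedTree}(n)) = \left\{ \mathrm{mod}(1-n,3)\, \left((012)^{n/6}\right)^R (012)^{(n-2)/6} \right\},\] and if $n \geq 3$ is odd, then \[\mathrm{ParseWords}(\mathrm{LeftCombTree}(n), \mathrm{RightCrookedTree}(n)) = \left\{ \mathrm{mod}(1-n,3)\, \left((012)^{(n-3)/6}\right)^R (012)^{(n+1)/6} \right\}.\] (Sets of equivalence classes are written by listing one representative of each class; juxtaposition is concatenation, the value $\mathrm{mod}(1-n,3)\in\{0,1,2\}$ being a single letter.)
   Context: A binary tree is a rooted ordered tree in which each vertex has either $0$ or $2$ children; its leaves are ordered left to right. Let $G$ be the context-free grammar with start symbols $0,1,2$ and rules $0\to 12$, $0\to 21$, $1\to 02$, $1\to 20$, $2\to 01$, $2\to 10$. An $n$-leaf binary tree $T$ parses a word $w$ of length $n$ on $\{0,1,2\}$ if there is a labeling of the vertices of $T$ by $0,1,2$ such that the leaves, from left to right, are labeled with the letters of $w$, and at every internal vertex the label of the vertex together with the labels of its left and right children form a rule of $G$ (i.e. the three labels are pairwise distinct). If $T$ parses $w$, it also parses every word obtained from $w$ by permuting the alphabet $\{0,1,2\}$. For $n$-leaf binary trees $T_1,T_2$, $\mathrm{ParseWords}(T_1,T_2)$ denotes the set of equivalence classes (under permutations of the alphabet $\{0,1,2\}$) of words parsed by both $T_1$ and $T_2$; it is written by listing one representative of each class. If $w=w_1\cdots w_m$ is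 a word of length $m$ and $x\ge 0$ is a rational number whose denominator in lowest terms divides $m$, then $w^x = w^{\lfloor x\rfloor} w_1 w_2\cdots w_{m(x-\lfloor x\rfloor)}$ is the word of length $mx$ consisting of repeated copies of $w$ truncated at $mx$ letters. $w^R$ is the left–right reversal of $w$. $\mathrm{mod}(a,3)$ is the smallest nonnegative integer congruent to $a$ modulo $3$. The level of a vertex is its distance from the root. A path tree is a binary tree with at most two vertices on each level. For $n\ge 2$, $n$-leaf path trees correspond bijectively to words $x_1\cdots x_{n-2}$ on $\{l,r\}$: $x_j=l$ (resp. $x_j=r$) means that, of the two vertices on level $j$, the left (resp. right) one has children. $\mathrm{LeftCombTree}(n)$ is the $n$-leaf path tree corresponding to $l^{n-2}$. $\mathrm{RightCrookedTree}(n)$ is the $n$-leaf path tree corresponding to $(rl)^{(n-2)/2}$, i.e. the word $rlrl\cdots$ of length $n-2$. -}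

module Defs where

open import Data.Fin.Base using (Fin; fromℕ<)
open import Data.Fin.Patterns using (0F; 1F; 2F)
open import Data.Fin.Permutation using (Permutation′; _⟨$⟩ʳ_; _⟨$⟩ˡ_; inverseˡ)
open import Data.Integer.Base as ℤ using (ℤ; +_; _%ℕ_)
open import Data.Integer.DivMod using (n%ℕd<d)
open import Data.List.Base as List using (List; []; _∷_; _++_; length; take; replicate; concat)
open import Data.List.Relation.Unary.Any using (Any)
open import Data.Nat.Base as ℕ using (ℕ; zero; suc; _∸_; _≤_; z≤n; s≤s)
open import Data.Nat.Properties using (≤-reflexive; +-comm; +-identityʳ; ≤-trans)
open import Data.Product.Base using (∃; _×_; _,_)
open import Data.Rational.Unnormalised.Base as ℚᵘ using (ℚᵘ; floor; _/_)
open import Data.Tree.Binary as Tree using (Tree; leaf; node; #leaves; module Leaves)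
open import Data.Unit.Base using (⊤; tt)
open import Function.Base using (const)
open import Level using (0ℓ)
open import Relation.Binary.PropositionalEquality using (_≡_; _≢_; refl; sym; trans; cong; cong₂)
open import Relation.Nullary.Negation using (contradiction)
open import Relation.Unary using (Pred)

Letter : Set
Letter = Fin 3

Word : Set
Word = List Letter

BinaryTree : Set
BinaryTree = Tree ⊤ ⊤

data Rule : Letter → Letter → Letter → Set where
  0→12 : Rule 0F 1F 2F
  0→21 : Rule 0F 2F 1F
  1→02 : Rule 1F 0F 2F
  1→20 : Rule 1F 2F 0F
  2→01 : Rule 2F 0F 1F
  2→10 : Rule 2F 1F 0F

-- A labeling of the vertices of T is a tree of letters whose shape is T.

LabeledTree : Set
LabeledTree = Tree Letter Letter

shape : LabeledTree → BinaryTree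
shape = Tree.map (const tt) (const tt)

rootLabel : LabeledTree → Letter
rootLabel (leaf a)     = a
rootLabel (node _ a _) = a

FollowsRules : LabeledTree → Set
FollowsRules (leaf _)     = ⊤
FollowsRules (node t a u) =
  Rule a (rootLabel t) (rootLabel u) × FollowsRules t × FollowsRules u

_Parses_ : BinaryTree → Word → Set
T Parses w = ∃ λ (L : LabeledTree) →
  shape L ≡ T × Leaves.toList L ≡ w × FollowsRules L

infix 4 _∼_

_∼_ : Word → Word → Set
u ∼ v = ∃ λ (π : Permutation′ 3) → List.map (π ⟨$⟩ʳ_) u ≡ v

-- A set of ∼-classes is represented by the ∼-closed predicate on words that
-- holds of the members of its classes; equality of sets of classes is then _≐_.
-- (ParseWords is shown ∼-closed in ParseWords-resp-∼.)

ParseWords : BinaryTree → BinaryTree → Pred Word 0ℓ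
ParseWords T₁ T₂ w = T₁ Parses w × T₂ Parses w

classesOf : List Word → Pred Word 0ℓ
classesOf us w = Any (w ∼_) us

infixr 8 _^_

-- Fractional power: ⌊x⌋ copies of w, then the first m (x − ⌊x⌋) letters of w,
-- where m = length w.  Meaningful for x ≥ 0 whose reduced denominator divides
-- m, in which case the outer floor is taken of an integer.

_^_ : ∀ {A : Set} → List A → ℚᵘ → List A
w ^ x = concat (replicate ℤ.∣ floor x ∣ w) ++ take ℤ.∣ floor rest ∣ w
  where
  rest : ℚᵘ
  rest = (+ length w / 1) ℚᵘ.* (x ℚᵘ.- (floor x / 1))

mod3 : ℤ → Letter
mod3 a = fromℕ< (n%ℕd<d a 3)

w012 : Word
w012 = 0F ∷ 1F ∷ 2F ∷ []

data Side : Set where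
  l r : Side

-- The j-th letter selects which of the two vertices on level j has children;
-- the root always has children, so k letters give a tree with k + 2 leaves.

pathTree : List Side → BinaryTree
pathTree []       = node (leaf tt) tt (leaf tt)
pathTree (l ∷ xs) = node (pathTree xs) tt (leaf tt)
pathTree (r ∷ xs) = node (leaf tt) tt (pathTree xs)

-- Both trees are meant for n ≥ 2 only.

LeftCombTree : ℕ → BinaryTree
LeftCombTree n = pathTree (replicate (n ∸ 2) l)

RightCrookedTree : ℕ → BinaryTree
RightCrookedTree n = pathTree ((r ∷ l ∷ []) ^ ((+ n ℤ.- + 2) / 2))

#leaves-pathTree : ∀ xs → #leaves (pathTree xs) ≡ 2 ℕ.+ length xs
#leaves-pathTree []       = refl
#leaves-pathTree (l ∷ xs) = trans (+-comm _ 1) (cong suc (#leaves-pathTree xs))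
#leaves-pathTree (r ∷ xs) = cong suc (#leaves-pathTree xs)

#vertices : BinaryTree → (level : ℕ) → ℕ
#vertices _            zero    = 1
#vertices (leaf _)     (suc _) = 0
#vertices (node t _ u) (suc k) = #vertices t k ℕ.+ #vertices u k

#vertices-pathTree : ∀ xs k → #vertices (pathTree xs) k ≤ 2
#vertices-pathTree _        zero          = s≤s z≤n
#vertices-pathTree []       (suc zero)    = s≤s (s≤s z≤n)
#vertices-pathTree (l ∷ xs) (suc zero)    = s≤s (s≤s z≤n)
#vertices-pathTree (r ∷ xs) (suc zero)    = s≤s (s≤s z≤n)
#vertices-pathTree []       (suc (suc k)) = z≤n
#vertices-pathTree (l ∷ xs) (suc (suc k)) =
  ≤-trans (≤-reflexive (+-identityʳ _)) (#vertices-pathTree xs (suc k))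
#vertices-pathTree (r ∷ xs) (suc (suc k)) = #vertices-pathTree xs (suc k)

private
  Rule⇒distinct : ∀ {a b c} → Rule a b c → a ≢ b × a ≢ c × b ≢ c
  Rule⇒distinct 0→12 = (λ ()) , (λ ()) , (λ ())
  Rule⇒distinct 0→21 = (λ ()) , (λ ()) , (λ ())
  Rule⇒distinct 1→02 = (λ ()) , (λ ()) , (λ ())
  Rule⇒distinct 1→20 = (λ ()) , (λ ()) , (λ ())
  Rule⇒distinct 2→01 = (λ ()) , (λ ()) , (λ ())
  Rule⇒distinct 2→10 = (λ ()) , (λ ()) , (λ ())

  distinct⇒Rule : ∀ a b c → a ≢ b → a ≢ c → b ≢ c → Rule a b c
  distinct⇒Rule 0F 1F 2F _ _ _ = 0→12
  distinct⇒Rule 0F 2F 1F _ _ _ = 0→21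
  distinct⇒Rule 1F 0F 2F _ _ _ = 1→02
  distinct⇒Rule 1F 2F 0F _ _ _ = 1→20
  distinct⇒Rule 2F 0F 1F _ _ _ = 2→01
  distinct⇒Rule 2F 1F 0F _ _ _ = 2→10
  distinct⇒Rule 0F 0F _  p _ _ = contradiction refl p
  distinct⇒Rule 1F 1F _  p _ _ = contradiction refl p
  distinct⇒Rule 2F 2F _  p _ _ = contradiction refl p
  distinct⇒Rule 0F 1F 0F _ q _ = contradiction refl q
  distinct⇒Rule 0F 2F 0F _ q _ = contradiction refl q
  distinct⇒Rule 1F 0F 1F _ q _ = contradiction refl q
  distinct⇒Rule 1F 2F 1F _ q _ = contradiction refl q
  distinct⇒Rule 2F 0F 2F _ q _ = contradiction refl q
  distinct⇒Rule 2F 1F 2F _ q _ = contradiction refl q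
  distinct⇒Rule 0F 1F 1F _ _ s = contradiction refl s
  distinct⇒Rule 0F 2F 2F _ _ s = contradiction refl s
  distinct⇒Rule 1F 0F 0F _ _ s = contradiction refl s
  distinct⇒Rule 1F 2F 2F _ _ s = contradiction refl s
  distinct⇒Rule 2F 0F 0F _ _ s = contradiction refl s
  distinct⇒Rule 2F 1F 1F _ _ s = contradiction refl s

  module _ (π : Permutation′ 3) where

    relabel : LabeledTree → LabeledTree
    relabel = Tree.map (π ⟨$⟩ʳ_) (π ⟨$⟩ʳ_)

    permuteRule : ∀ {a b c} → Rule a b c →
                  Rule (π ⟨$⟩ʳ a) (π ⟨$⟩ʳ b) (π ⟨$⟩ʳ c)
    permuteRule ρ = let p , q , s = Rule⇒distinct ρ in
      distinct⇒Rule _ _ _ (λ e → p (inj e)) (λ e → q (inj e)) (λ e → s (inj e))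
      where
      inj : ∀ {x y} → π ⟨$⟩ʳ x ≡ π ⟨$⟩ʳ y → x ≡ y
      inj e = trans (sym (inverseˡ π)) (trans (cong (π ⟨$⟩ˡ_) e) (inverseˡ π))

    shape-relabel : ∀ L → shape (relabel L) ≡ shape L
    shape-relabel (leaf _)     = refl
    shape-relabel (node t _ u) =
      cong₂ (λ t′ u′ → node t′ tt u′) (shape-relabel t) (shape-relabel u)

    leaves-relabel : ∀ L {ks ks′} → ks′ ≡ List.map (π ⟨$⟩ʳ_) ks →
      Leaves.toDiffList (relabel L) ks′ ≡ List.map (π ⟨$⟩ʳ_) (Leaves.toDiffList L ks)
    leaves-relabel (leaf a)     e = cong (π ⟨$⟩ʳ a ∷_) e
    leaves-relabel (node t _ u) e = leaves-relabel t (leaves-relabel u e)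

    rootLabel-relabel : ∀ L → rootLabel (relabel L) ≡ π ⟨$⟩ʳ rootLabel L
    rootLabel-relabel (leaf _)     = refl
    rootLabel-relabel (node _ _ _) = refl

    followsRules-relabel : ∀ L → FollowsRules L → FollowsRules (relabel L)
    followsRules-relabel (leaf _)     _           = tt
    followsRules-relabel (node t a u) (ρ , f , g)
      rewrite rootLabel-relabel t | rootLabel-relabel u =
      permuteRule ρ , followsRules-relabel t f , followsRules-relabel u g

Parses-resp-∼ : ∀ {T u v} → u ∼ v → T Parses u → T Parses v
Parses-resp-∼ (π , refl) (L , refl , refl , f) =
  relabel π L , shape-relabel π L , leaves-relabel π L refl , followsRules-relabel π L f

ParseWords-resp-∼ : ∀ {T₁ T₂ u v} → u ∼ v → ParseWords T₁ T₂ u → ParseWords T₁ T₂ v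
ParseWords-resp-∼ u∼v (p , q) = Parses-resp-∼ u∼v p , Parses-resp-∼ u∼v q

{-# OPTIONS --safe #-}

-- Read the letters as the nonzero elements of the Klein four-group, so that
-- every vertex is labeled with the sum of the leaves below it.  With
-- S_k = w₁ + ⋯ + w_k, the left comb parses w iff S₁, …, S_n are nonzero and
-- consecutive ones differ; given this, the crooked tree parses w iff
-- consecutive entries of the zigzag S_n, S₁, S_{n−1}, S₂, S_{n−2}, … differ.
-- Entries of the zigzag at distance two are consecutive prefix sums, so any
-- three consecutive entries are distinct, i.e. the zigzag has period 3.  Up to
-- permuting the alphabet this leaves exactly one word, which winds inwards.

module Submission where

open import Defs
open import Data.Fin.Patterns using (0F; 1F; 2F)
open import Data.Fin.Permutation using (Permutation′; _⟨$⟩ʳ_; _⟨$⟩ˡ_; _∘ₚ_; flip; id; transpose; inverseˡ)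
open import Data.Integer.Base as ℤ using (+_; -[1+_])
import Data.Integer.DivMod as ℤ
import Data.Integer.Properties as ℤ
open import Data.List.Base using (List; []; _∷_; _++_; _∷ʳ_; [_]; length; reverse; map; replicate; concat; take)
open import Data.List.Properties using (++-assoc; ++-identityʳ; length-++; map-++; map-∘; map-id; map-cong; reverse-++)
open import Data.List.Relation.Unary.Any using (here)
open import Data.Nat.Base as ℕ using (ℕ; zero; suc; _≥_; s≤s)
open import Data.Nat.Divisibility using (_∣_; divides)
import Data.Nat.DivMod as ℕ
import Data.Nat.Properties as ℕ
open import Data.Product.Base using (∃; ∃₂; _×_; _,_)
open import Data.Rational.Unnormalised.Base as ℚᵘ using (mkℚᵘ; floor; _/_)
open import Data.Tree.Binary using (leaf; node; module Leaves)
open import Data.Unit.Base using (tt)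
open import Relation.Binary.PropositionalEquality using (_≡_; refl; sym; trans; cong; cong₂; subst; subst₂; module ≡-Reasoning)
open import Relation.Nullary.Negation using (¬_; contradiction)
open import Relation.Unary using (_≐_)

-- Derivations: trees with a root label and a leaf word.

data Derives : BinaryTree → Letter → Word → Set where
  leaf : ∀ {a} → Derives (leaf tt) a [ a ]
  node : ∀ {T₁ T₂ a b c u v} → Rule a b c → Derives T₁ b u → Derives T₂ c v →
         Derives (node T₁ tt T₂) a (u ++ v)

-- Leaves are listed through an accumulator, so the induction needs the equation for every tail
-- `ks`.
labeling⇒derives : ∀ L → FollowsRules L → ∃ λ w →
  Derives (shape L) (rootLabel L) w × (∀ ks → Leaves.toDiffList L ks ≡ w ++ ks)
labeling⇒derives (leaf a) _ = _ , leaf , λ _ → refl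
labeling⇒derives (node L₁ a L₂) (ρ , f , g)
  with u , d , p ← labeling⇒derives L₁ f | v , e , q ← labeling⇒derives L₂ g =
  _ , node ρ d e , λ ks →
    trans (p _) (trans (cong (u ++_) (q ks)) (sym (++-assoc u v ks)))

derives⇒labeling : ∀ {T a w} → Derives T a w → ∃ λ L →
  shape L ≡ T × rootLabel L ≡ a × FollowsRules L × (∀ ks → Leaves.toDiffList L ks ≡ w ++ ks)
derives⇒labeling (leaf {a}) = leaf a , refl , refl , tt , λ _ → refl
derives⇒labeling (node {u = u} {v} ρ d e)
  with L₁ , refl , refl , f , p ← derives⇒labeling d
     | L₂ , refl , refl , g , q ← derives⇒labeling e =
  node L₁ _ L₂ , refl , refl , (ρ , f , g) , λ ks →
    trans (p _) (trans (cong (u ++_) (q ks)) (sym (++-assoc u v ks)))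

parses⇒derives : ∀ {T w} → T Parses w → ∃ λ a → Derives T a w
parses⇒derives (L , refl , refl , f)
  with w , d , p ← labeling⇒derives L f
  rewrite p [] | ++-identityʳ w = _ , d

derives⇒parses : ∀ {T a w} → Derives T a w → T Parses w
derives⇒parses {w = w} d with L , s , _ , f , p ← derives⇒labeling d =
  L , s , trans (p []) (++-identityʳ w) , f

-- Left combs as walks of prefix sums.

-- Walk p u q: a left comb whose first leaf is labeled p and whose other
-- leaves spell u has root label q.

data Walk : Letter → Word → Letter → Set where
  []  : ∀ {p} → Walk p [] p
  _∷_ : ∀ {p m q x u} → Rule m p x → Walk m u q → Walk p (x ∷ u) q

infixr 5 _++ʷ_

_++ʷ_ : ∀ {p m q u v} → Walk p u m → Walk m v q → Walk p (u ++ v) q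
[]      ++ʷ ω′ = ω′
(ρ ∷ ω) ++ʷ ω′ = ρ ∷ (ω ++ʷ ω′)

splitWalk : ∀ {p q} u {v} → Walk p (u ++ v) q → ∃ λ m → Walk p u m × Walk m v q
splitWalk []      ω       = _ , [] , ω
splitWalk (_ ∷ u) (ρ ∷ ω) with m , ω₁ , ω₂ ← splitWalk u ω = m , ρ ∷ ω₁ , ω₂

comb : ℕ → BinaryTree
comb zero    = leaf tt
comb (suc k) = node (comb k) tt (leaf tt)

pathTree-l : ∀ k → pathTree (replicate k l) ≡ comb (suc k)
pathTree-l zero    = refl
pathTree-l (suc k) = cong (λ T → node T tt (leaf tt)) (pathTree-l k)

comb⇒walk : ∀ k {q w} → Derives (comb k) q w → ∃₂ λ p u → w ≡ p ∷ u × Walk p u q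
comb⇒walk zero leaf = _ , _ , refl , []
comb⇒walk (suc k) (node ρ d leaf) with p , u , refl , ω ← comb⇒walk k d =
  p , _ , refl , ω ++ʷ (ρ ∷ [])

-- A comb grows at its root while a walk is read from its first letter, so the comb over the prefix
-- `v` already read is carried along.
walk⇒comb : ∀ j {p q v u} → Derives (comb j) p v → Walk p u q →
            Derives (comb (length u ℕ.+ j)) q (v ++ u)
walk⇒comb j {v = v} d [] = subst (Derives _ _) (sym (++-identityʳ v)) d
walk⇒comb j {q = q} {v} {x ∷ u} d (ρ ∷ ω) =
  subst₂ (λ i → Derives (comb i) q) (ℕ.+-suc (length u) j) (++-assoc v [ x ] u)
         (walk⇒comb (suc j) (node ρ d leaf) ω)

rule-swap : ∀ {a b c} → Rule a b c → Rule a c b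
rule-swap 0→12 = 0→21
rule-swap 0→21 = 0→12
rule-swap 1→02 = 1→20
rule-swap 1→20 = 1→02
rule-swap 2→01 = 2→10
rule-swap 2→10 = 2→01

rule-rotate : ∀ {a b c} → Rule a b c → Rule c a b
rule-rotate 0→12 = 2→01
rule-rotate 0→21 = 1→02
rule-rotate 1→02 = 2→10
rule-rotate 1→20 = 0→12
rule-rotate 2→01 = 1→20
rule-rotate 2→10 = 0→21

-- Distinctness leaves no choice: `m` and `a` are both the letter other than `b` and `c`, whence `q`
-- is `b` and `p` is `c`.
rule-node : ∀ {p m q a b c} → Rule m p b → Rule q m c → Rule a b c →
            Rule q p a × m ≡ a × b ≡ q × c ≡ p
rule-node 0→12 2→01 0→21 = 2→10 , refl , refl , refl
rule-node 0→21 1→02 0→12 = 1→20 , refl , refl , refl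
rule-node 1→02 2→10 1→20 = 2→01 , refl , refl , refl
rule-node 1→20 0→12 1→02 = 0→21 , refl , refl , refl
rule-node 2→01 1→20 2→10 = 1→02 , refl , refl , refl
rule-node 2→10 0→21 2→01 = 0→12 , refl , refl , refl

-- A walk from p to q along w adds the sum of w to p, and that sum is the root
-- label of every tree deriving w.

walk-root : ∀ {T p q a w} → Derives T a w → Walk p w q → Rule q p a
walk-root leaf (ρ ∷ []) = ρ
walk-root (node {u = u} ρ d e) ω
  with m , ω₁ , ω₂ ← splitWalk u ω
  with σ , _ ← rule-node (walk-root d ω₁) (walk-root e ω₂) ρ = σ

-- The crooked tree and its forced word.

-- The right subtree of the root of RightCrookedTree (k + 2).

crook : ℕ → BinaryTree
crook 0             = leaf tt
crook 1             = node (leaf tt) tt (leaf tt)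
crook (suc (suc k)) = node (node (leaf tt) tt (crook k)) tt (leaf tt)

zigzag : ℕ → List Side
zigzag 0             = []
zigzag 1             = r ∷ []
zigzag (suc (suc k)) = r ∷ l ∷ zigzag k

pathTree-zigzag : ∀ k → pathTree (zigzag k) ≡ node (leaf tt) tt (crook k)
pathTree-zigzag 0             = refl
pathTree-zigzag 1             = refl
pathTree-zigzag (suc (suc k)) =
  cong (λ T → node (leaf tt) tt (node T tt (leaf tt))) (pathTree-zigzag k)

-- The letters that crook k is forced to derive when the prefix sums just
-- before and at the end of its leaves are p and q, t being the third letter.

spiral : ℕ → Letter → Letter → Letter → Word
spiral 0             p q t = [ t ]
spiral 1             p q t = q ∷ p ∷ []
spiral (suc (suc k)) p q t = t ∷ spiral k q t p ∷ʳ p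

-- Each turn fixes the first and last leaf. Between them the prefix sums run from `q` to `t`, so the
-- induction continues with the three letters rotated.
spiral-unique : ∀ k {p q t u} → Derives (crook k) t u → Walk p u q → u ≡ spiral k p q t
spiral-unique 0 leaf _ = refl
spiral-unique 1 (node ρ leaf leaf) (σ ∷ τ ∷ [])
  with _ , refl , refl , refl ← rule-node σ τ ρ = refl
spiral-unique (suc (suc k)) (node ρ (node {v = u} ρ′ leaf d) leaf) (σ ∷ ω)
  with m , ω′ , τ ∷ [] ← splitWalk u ω
  -- By `walk-root` the inner crook moves the prefix sum like the single letter at its root, so
  -- `rule-node` applies to the lower node and then to the upper one.
  with υ , refl , refl , refl ← rule-node σ (walk-root d ω′) ρ′
  with _ , refl , refl , refl ← rule-node υ τ ρ
  = cong (λ v → _ ∷ v ∷ʳ _) (spiral-unique k d ω′)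

spiral-walk : ∀ k {p q t} → Rule q p t → Walk p (spiral k p q t) q
spiral-walk 0 ρ = ρ ∷ []
spiral-walk 1 ρ = rule-swap (rule-rotate ρ) ∷ rule-swap ρ ∷ []
spiral-walk (suc (suc k)) ρ =
  ρ ∷ spiral-walk k (rule-rotate ρ) ++ʷ (rule-swap ρ ∷ [])

spiral-derives : ∀ k {p q t} → Rule q p t → Derives (crook k) t (spiral k p q t)
spiral-derives 0 ρ = leaf
spiral-derives 1 ρ = node (rule-rotate ρ) leaf leaf
spiral-derives (suc (suc k)) ρ =
  node (rule-rotate ρ) (node (rule-swap ρ) leaf (spiral-derives k (rule-rotate ρ))) leaf

map-spiral : ∀ (f : Letter → Letter) k p q t →
             map f (spiral k p q t) ≡ spiral k (f p) (f q) (f t)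
map-spiral f 0             p q t = refl
map-spiral f 1             p q t = refl
map-spiral f (suc (suc k)) p q t =
  cong (f t ∷_) (trans (map-++ f (spiral k q t p) [ p ])
                       (cong (_∷ʳ f p) (map-spiral f k q t p)))

length-spiral : ∀ k {p q t} → length (spiral k p q t) ≡ suc k
length-spiral 0             = refl
length-spiral 1             = refl
length-spiral (suc (suc k)) {p} {q} {t} =
  cong suc (trans (length-++ (spiral k q t p)) (trans (ℕ.+-comm _ 1) (cong suc (length-spiral k))))

module _ (k : ℕ) where

  private
    Common : Word → Set
    Common = ParseWords (comb (suc k)) (node (leaf tt) tt (crook k))

  -- The first letter is both the left leaf below the root of the crooked tree and the start of the
  -- comb's walk; the rest is thus a walk that `crook k` derives.
  common⇒spiral : ∀ {w} → Common w →
    ∃₂ λ p q → ∃ λ t → Rule q p t × w ≡ p ∷ spiral k p q t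
  common⇒spiral (c , z)
    with _ , d ← parses⇒derives c | _ , node {v = v} _ leaf e ← parses⇒derives z
    with p , u , eq , ω ← comb⇒walk (suc k) d
    with refl ← eq
    = _ , _ , _ , walk-root e ω , cong (p ∷_) (spiral-unique k e ω)

  spiral⇒common : ∀ {p q t} → Rule q p t → Common (p ∷ spiral k p q t)
  spiral⇒common {p} {q} {t} ρ =
    derives⇒parses (subst (λ j → Derives (comb j) q (p ∷ spiral k p q t))
      (trans (ℕ.+-identityʳ _) (length-spiral k))
      (walk⇒comb 0 leaf (spiral-walk k ρ))) ,
    derives⇒parses (node ρ leaf (spiral-derives k ρ))

-- Uniqueness up to permuting the alphabet.

-- The six rules match the six permutations of the alphabet; `_∘ₚ_` applies its left factor first.
ruleColour : ∀ {a b c} → Rule a b c → Permutation′ 3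
ruleColour 0→12 = id
ruleColour 0→21 = transpose 1F 2F
ruleColour 1→02 = transpose 0F 1F
ruleColour 1→20 = transpose 0F 1F ∘ₚ transpose 0F 2F
ruleColour 2→01 = transpose 0F 2F ∘ₚ transpose 0F 1F
ruleColour 2→10 = transpose 0F 2F

ruleColour-letters : ∀ {a b c} (ρ : Rule a b c) → let π = ruleColour ρ in
  π ⟨$⟩ʳ 0F ≡ a × π ⟨$⟩ʳ 1F ≡ b × π ⟨$⟩ʳ 2F ≡ c
ruleColour-letters 0→12 = refl , refl , refl
ruleColour-letters 0→21 = refl , refl , refl
ruleColour-letters 1→02 = refl , refl , refl
ruleColour-letters 1→20 = refl , refl , refl
ruleColour-letters 2→01 = refl , refl , refl
ruleColour-letters 2→10 = refl , refl , refl

-- The route passes through 0, 1, 2: back along `π`, then out along `π′`.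
recolour : ∀ {a b c a′ b′ c′} → Rule a b c → Rule a′ b′ c′ → ∃ λ (π : Permutation′ 3) →
  π ⟨$⟩ʳ a ≡ a′ × π ⟨$⟩ʳ b ≡ b′ × π ⟨$⟩ʳ c ≡ c′
recolour ρ ρ′ =
  let a , b , c = ruleColour-letters ρ ; a′ , b′ , c′ = ruleColour-letters ρ′
  in flip π ∘ₚ π′ , via a a′ , via b b′ , via c c′
  where
  π π′ : Permutation′ 3
  π  = ruleColour ρ
  π′ = ruleColour ρ′
  via : ∀ {i x y} → π ⟨$⟩ʳ i ≡ x → π′ ⟨$⟩ʳ i ≡ y → π′ ⟨$⟩ʳ (π ⟨$⟩ˡ x) ≡ y
  via refl refl = cong (π′ ⟨$⟩ʳ_) (inverseˡ π)

∼-sym : ∀ {u v} → u ∼ v → v ∼ u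
∼-sym {u} (π , refl) = flip π ,
  trans (sym (map-∘ u)) (trans (map-cong (λ _ → inverseˡ π) u) (map-id u))

spiral-∼ : ∀ k {p q t p′ q′ t′} → Rule q p t → Rule q′ p′ t′ →
           p ∷ spiral k p q t ∼ p′ ∷ spiral k p′ q′ t′
spiral-∼ k {p} {q} {t} ρ ρ′ with π , refl , refl , refl ← recolour ρ ρ′ =
  π , cong (π ⟨$⟩ʳ p ∷_) (map-spiral (π ⟨$⟩ʳ_) k p q t)

common≐spiral : ∀ k {p q t} → Rule q p t →
  ParseWords (comb (suc k)) (node (leaf tt) tt (crook k)) ≐
  classesOf ((p ∷ spiral k p q t) ∷ [])
common≐spiral k ρ = to , from
  where
  to : ∀ {w} → ParseWords (comb (suc k)) (node (leaf tt) tt (crook k)) w → _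
  to c with _ , _ , _ , σ , refl ← common⇒spiral k c = here (spiral-∼ k σ ρ)
  from : ∀ {w} → classesOf (_ ∷ []) w → _
  from (here w∼) = ParseWords-resp-∼ (∼-sym w∼) (spiral⇒common k ρ)

-- Fractional powers by natural-number division.

floor-/ : ∀ a b → floor (+ a / suc b) ≡ + (a ℕ./ suc b)
floor-/ a b = ℤ.div-pos-is-/ℕ (+ a) (suc b)

-- The other denominators are 1, so `suc b` survives unreduced and the fractions agree on the nose;
-- the numerators agree by division with remainder.
frac-/ : ∀ L a b → (+ L / 1) ℚᵘ.* ((+ a / suc b) ℚᵘ.- (+ (a ℕ./ suc b) / 1)) ≡
                   + (L ℕ.* (a ℕ.% suc b)) / suc b
frac-/ L a b = cong₂ mkℚᵘ numerator (trans (ℕ.+-identityʳ _) (ℕ.*-identityʳ b))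
  where
  q = a ℕ./ suc b
  numerator : + L ℤ.* (+ a ℤ.* + 1 ℤ.+ ℤ.- (+ q) ℤ.* + suc b) ≡ + (L ℕ.* (a ℕ.% suc b))
  numerator = begin
    + L ℤ.* (+ a ℤ.* + 1 ℤ.+ ℤ.- (+ q) ℤ.* + suc b)
      ≡⟨ cong (+ L ℤ.*_) (cong₂ ℤ._+_ (ℤ.*-identityʳ (+ a))
           (trans (sym (ℤ.neg-distribˡ-* (+ q) (+ suc b))) (cong ℤ.-_ (sym (ℤ.pos-* q (suc b)))))) ⟩
    + L ℤ.* (+ a ℤ.- + (q ℕ.* suc b))
      ≡⟨ cong (λ i → + L ℤ.* (i ℤ.- + (q ℕ.* suc b))) (cong +_ (ℕ.m≡m%n+[m/n]*n a (suc b))) ⟩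
    + L ℤ.* (+ (a ℕ.% suc b) ℤ.+ + (q ℕ.* suc b) ℤ.- + (q ℕ.* suc b))
      ≡⟨ cong (+ L ℤ.*_) (trans (ℤ.+-assoc (+ (a ℕ.% suc b)) (+ (q ℕ.* suc b)) (ℤ.- + (q ℕ.* suc b)))
           (trans (cong (λ i → + (a ℕ.% suc b) ℤ.+ i) (ℤ.+-inverseʳ (+ (q ℕ.* suc b)))) (ℤ.+-identityʳ _))) ⟩
    + L ℤ.* + (a ℕ.% suc b)
      ≡⟨ ℤ.pos-* L _ ⟨
    + (L ℕ.* (a ℕ.% suc b)) ∎
    where open ≡-Reasoning

^-/ : ∀ {A : Set} (w : List A) a b →
      w ^ (+ a / suc b) ≡
      concat (replicate (a ℕ./ suc b) w) ++ take (length w ℕ.* (a ℕ.% suc b) ℕ./ suc b) w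
^-/ w a b = begin
  w ^ (+ a / suc b)
    ≡⟨ cong (λ f → concat (replicate ℤ.∣ f ∣ w) ++
         take ℤ.∣ floor ((+ length w / 1) ℚᵘ.* ((+ a / suc b) ℚᵘ.- (f / 1))) ∣ w) (floor-/ a b) ⟩
  whole ++ take ℤ.∣ floor ((+ length w / 1) ℚᵘ.* ((+ a / suc b) ℚᵘ.- (+ (a ℕ./ suc b) / 1))) ∣ w
    ≡⟨ cong (λ x → whole ++ take ℤ.∣ x ∣ w)
         (trans (cong floor (frac-/ (length w) a b)) (floor-/ (length w ℕ.* (a ℕ.% suc b)) b)) ⟩
  whole ++ take (length w ℕ.* (a ℕ.% suc b) ℕ./ suc b) w ∎
  where
  open ≡-Reasoning
  whole = concat (replicate (a ℕ./ suc b) w)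

^-1+ : ∀ {A : Set} (w : List A) a b →
       w ^ (+ (suc b ℕ.+ a) / suc b) ≡ w ++ w ^ (+ a / suc b)
^-1+ w a b = begin
  w ^ (+ (suc b ℕ.+ a) / suc b)                  ≡⟨ ^-/ w (suc b ℕ.+ a) b ⟩
  copies ((suc b ℕ.+ a) ℕ./ suc b) ++ part ((suc b ℕ.+ a) ℕ.% suc b)
    ≡⟨ cong₂ (λ i j → copies i ++ part j) quotient remainder ⟩
  copies (suc (a ℕ./ suc b)) ++ part (a ℕ.% suc b) ≡⟨ ++-assoc w (copies (a ℕ./ suc b)) _ ⟩
  w ++ copies (a ℕ./ suc b) ++ part (a ℕ.% suc b)  ≡⟨ cong (w ++_) (^-/ w a b) ⟨
  w ++ w ^ (+ a / suc b) ∎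
  where
  open ≡-Reasoning
  copies part : ℕ → List _
  copies i = concat (replicate i w)
  part j = take (length w ℕ.* j ℕ./ suc b) w
  quotient : (suc b ℕ.+ a) ℕ./ suc b ≡ suc (a ℕ./ suc b)
  quotient = trans (ℕ.m/n≡1+[m∸n]/n (ℕ.m≤m+n (suc b) a))
                   (cong (λ i → suc (i ℕ./ suc b)) (ℕ.m+n∸m≡n (suc b) a))
  remainder : (suc b ℕ.+ a) ℕ.% suc b ≡ a ℕ.% suc b
  remainder = trans (cong (ℕ._% suc b) (ℕ.+-comm (suc b) a)) (ℕ.[m+n]%n≡m%n a (suc b))

zigzag-^ : ∀ k → (r ∷ l ∷ []) ^ (+ k / 2) ≡ zigzag k
zigzag-^ 0             = refl
zigzag-^ 1             = refl
zigzag-^ (suc (suc k)) = trans (^-1+ _ k 1) (cong (λ v → r ∷ l ∷ v) (zigzag-^ k))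

-- The spiral in closed form.

-- The first `m` letters of 012012...; the exponent m/3 is kept over 6 to match the exponents of the
-- theorem.
cyclic : ℕ → Word
cyclic m = w012 ^ (+ (m ℕ.* 2) / 6)

letter : ℕ → Letter
letter 0                   = 0F
letter 1                   = 1F
letter 2                   = 2F
letter (suc (suc (suc m))) = letter m

-- Three more letters raise the exponent by 1, so the induction goes by threes through `^-1+`.
cyclic-suc : ∀ m → cyclic (suc m) ≡ cyclic m ∷ʳ letter m
cyclic-suc 0 = refl
cyclic-suc 1 = refl
cyclic-suc 2 = refl
cyclic-suc (suc (suc (suc m)))
  = trans (^-1+ w012 (suc m ℕ.* 2) 5)
   (trans (cong (w012 ++_) (cyclic-suc m))
          (cong (_∷ʳ letter m) (sym (^-1+ w012 (m ℕ.* 2) 5))))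

reverse-cyclic-suc : ∀ m → reverse (cyclic (suc m)) ≡ letter m ∷ reverse (cyclic m)
reverse-cyclic-suc m = trans (cong reverse (cyclic-suc m)) (reverse-++ (cyclic m) [ letter m ])

letter-rule : ∀ m → Rule (letter m) (letter (1 ℕ.+ m)) (letter (2 ℕ.+ m))
letter-rule 0                   = 0→12
letter-rule 1                   = 1→20
letter-rule 2                   = 2→01
letter-rule (suc (suc (suc m))) = letter-rule m

-- One turn of the spiral: both halves of the word grow outwards by a letter.

extend : ∀ a b → letter a ∷ (reverse (cyclic a) ++ cyclic b) ∷ʳ letter b ≡
                 reverse (cyclic (suc a)) ++ cyclic (suc b)
extend a b = begin
  letter a ∷ (reverse (cyclic a) ++ cyclic b) ∷ʳ letter b
    ≡⟨ cong (letter a ∷_) (++-assoc (reverse (cyclic a)) (cyclic b) _) ⟩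
  (letter a ∷ reverse (cyclic a)) ++ (cyclic b ∷ʳ letter b)
    ≡⟨ cong₂ _++_ (reverse-cyclic-suc a) (cyclic-suc b) ⟨
  reverse (cyclic (suc a)) ++ cyclic (suc b) ∎
  where open ≡-Reasoning

-- The arguments of spiral are those that make its innermost letter 0.

spiral-even : ∀ m → spiral (m ℕ.* 2) (letter (2 ℕ.+ m)) (letter (1 ℕ.+ m)) (letter m) ≡
                    reverse (cyclic (suc m)) ++ cyclic m
spiral-even zero    = refl
spiral-even (suc m) = trans (cong (λ u → letter (suc m) ∷ u ∷ʳ letter m) (spiral-even m)) (extend (suc m) m)

spiral-odd : ∀ m → spiral (suc (m ℕ.* 2)) (letter (1 ℕ.+ m)) (letter m) (letter (2 ℕ.+ m)) ≡
                    reverse (cyclic m) ++ cyclic (2 ℕ.+ m)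
spiral-odd zero    = refl
spiral-odd (suc m) = trans (cong (λ u → letter m ∷ u ∷ʳ letter (2 ℕ.+ m)) (spiral-odd m)) (extend m (2 ℕ.+ m))

-- For n = 2m + 2, 1 - n = -(2m + 1) ≡ m + 2 modulo 3.
mod3-even : ∀ m → mod3 -[1+ m ℕ.* 2 ] ≡ letter (2 ℕ.+ m)
mod3-even 0 = refl
mod3-even 1 = refl
mod3-even 2 = refl
mod3-even (suc (suc (suc m))) = mod3-even m

-- For n = 2m + 3, 1 - n = -(2m + 2) ≡ m + 1 modulo 3.
mod3-odd : ∀ m → mod3 -[1+ suc (m ℕ.* 2) ] ≡ letter (1 ℕ.+ m)
mod3-odd 0 = refl
mod3-odd 1 = refl
mod3-odd 2 = refl
mod3-odd (suc (suc (suc m))) = mod3-odd m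

-- Assembling the even and odd cases.

parseWords-≐ : ∀ k {p q t c u} → Rule q p t → c ≡ p → spiral k p q t ≡ u →
  ParseWords (LeftCombTree (2 ℕ.+ k)) (RightCrookedTree (2 ℕ.+ k)) ≐ classesOf ((c ∷ u) ∷ [])
parseWords-≐ k ρ refl refl
  rewrite pathTree-l k | zigzag-^ k | pathTree-zigzag k = common≐spiral k ρ

data Parity : ℕ → Set where
  even : ∀ m → Parity (m ℕ.* 2)
  odd  : ∀ m → Parity (suc (m ℕ.* 2))

parity : ∀ n → Parity n
parity zero = even 0
parity (suc n) with parity n
... | even m = odd m
... | odd m  = even (suc m)

parseWords-even : ∀ n → n ≥ 2 → 2 ∣ n →
  ParseWords (LeftCombTree n) (RightCrookedTree n) ≐
  classesOf ((mod3 (+ 1 ℤ.- + n) ∷ reverse (w012 ^ (+ n / 6)) ++ w012 ^ ((+ n ℤ.- + 2) / 6)) ∷ [])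
parseWords-even _ _ (divides (suc m) refl) =
  -- Here n = 2m + 2, and `letter (3 + m)` computes to `letter m`, the third letter of the rule.
  parseWords-≐ (m ℕ.* 2) (letter-rule (1 ℕ.+ m)) (mod3-even m) (spiral-even m)

parseWords-odd : ∀ n → n ≥ 3 → ¬ (2 ∣ n) →
  ParseWords (LeftCombTree n) (RightCrookedTree n) ≐
  classesOf ((mod3 (+ 1 ℤ.- + n) ∷ reverse (w012 ^ ((+ n ℤ.- + 3) / 6)) ++ w012 ^ ((+ n ℤ.+ + 1) / 6)) ∷ [])
parseWords-odd n n≥3 2∤n with parity n
... | even m = contradiction (divides m refl) 2∤n
... | odd zero = contradiction n≥3 (λ { (s≤s ()) })
-- Here n = 2m + 3; the rewrite turns n + 1 into `(2 + m) * 2`, the numerator in `cyclic (2 + m)`.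
... | odd (suc m) rewrite ℕ.+-comm (m ℕ.* 2) 1 =
  parseWords-≐ (suc (m ℕ.* 2)) (letter-rule m) (mod3-odd m) (spiral-odd m)

theorem6 : (n : ℕ) → n ≥ 2 →
    (2 ∣ n →
    ParseWords (LeftCombTree n) (RightCrookedTree n) ≐
    classesOf ((mod3 (+ 1 ℤ.- + n) ∷ reverse (w012 ^ (+ n / 6)) ++ w012 ^ ((+ n ℤ.- + 2) / 6)) ∷ []))
    ×
    (n ≥ 3 → ¬ (2 ∣ n) →
    ParseWords (LeftCombTree n) (RightCrookedTree n) ≐
    classesOf ((mod3 (+ 1 ℤ.- + n) ∷ reverse (w012 ^ ((+ n ℤ.- + 3) / 6)) ++ w012 ^ ((+ n ℤ.+ + 1) / 6)) ∷ []))
theorem6 n n≥2 = parseWords-even n n≥2 , parseWords-odd n
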